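{- Let $m$ be a positive integer, let $K$ be an integer with $0\le K\le m-1$, and let $a_1$ be a non-negative integer. Then $$S_m(\{a_1\},K)=\left\lfloor\frac{a_1}{m}\right\rfloor (K+1)+\max\bigl(0,\,(a_1 \bmod m)+K-m+1\bigr).$$
   Context: For a positive integer $m$ and non-negative integers $a_1,K$, define $$S_m(\{a_1\},K)=\sum_{k=0}^K\left(\left\lfloor\frac{a_1+k}{m}\right\rfloor-\left\lfloor\frac{k}{m}\right\rfloor\right).$$ For an integer $a$, $(a \bmod m)$ denotes the minimal non-negative representative of the class of $a$ in $\mathbb{Z}/m$, i.e. the integer in $\{0,\dots,m-1\}$ congruent to $a$ modulo $m$. -}

module Defs where

open import Data.Fin.Base using (toℕ)
open import Data.Integer.Base using (ℤ; +_; _-_)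
open import Data.Integer.Properties using (+-0-monoid)
open import Data.Nat.Base as ℕ using (ℕ; NonZero)

open import Algebra.Properties.Monoid.Sum +-0-monoid using (sum⁺-syntax)

-- The case of a single parameter a₁ of S_m({a₁}, K).  The arguments of the
-- floors are non-negative, so ℕ division is the floor; the subtraction is in ℤ.
S : (m : ℕ) .{{_ : NonZero m}} (a₁ K : ℕ) → ℤ
S m a₁ K = ∑[ k ≤ K ] (+ ((a₁ ℕ.+ toℕ k) ℕ./ m) - + (toℕ k ℕ./ m))

{-# OPTIONS --safe #-}
-- For k < m the k-th summand is ⌊(a₁ + k)/m⌋ = ⌊a₁/m⌋ + ⌊(r + k)/m⌋ with
-- r = a₁ mod m, and since r + k < 2m the last floor is exactly the increment
-- of the truncated difference (r + k) ∸ m when k grows by one.  The sum of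
-- these increments telescopes, starting from r ∸ m = 0.
module Submission where

open import Defs
open import Data.Fin.Base using (toℕ)
open import Data.Fin.Properties using (toℕ-fromℕ; toℕ-inject₁)
open import Data.Integer.Base using (ℤ; +_; 0ℤ; 1ℤ; -1ℤ; _+_; _-_; _*_; _⊔_; _≤_; _⊖_)
import Data.Integer.Properties as ℤ
open import Data.Integer.Tactic.RingSolver using (solve)
open import Data.List.Base using ([]; _∷_)
open import Data.Nat.Base as ℕ using (ℕ; NonZero; zero; suc)
open import Data.Nat.Divisibility using (divides-refl)
open import Data.Nat.DivMod
  using (+-distrib-/-∣ʳ; m%n<n; m<n⇒m/n≡0; m/n≡1+[m∸n]/n; m≡m%n+[m/n]*n; m*n/n≡m; /-congˡ)
import Data.Nat.Properties as ℕ
open import Data.Nat.Tactic.RingSolver using () renaming (solve to ℕ-solve)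
open import Data.Sum.Base using (inj₁; inj₂)
open import Relation.Binary.PropositionalEquality
  using (_≡_; refl; sym; trans; cong; cong₂; module ≡-Reasoning)

open import Algebra.Properties.Monoid.Sum ℤ.+-0-monoid using (sum-syntax; sum-cong-≗; sum-init-last)

-- Sums over `Fin` unfold at the first index, whereas the induction on the number of terms has to
-- split off the last one.
∑-toℕ-suc : (f : ℕ → ℤ) (n : ℕ) →
  ∑[ k < suc n ] f (toℕ k) ≡ ∑[ k < n ] f (toℕ k) + f n
∑-toℕ-suc f n = trans
  (sum-init-last {n} (λ k → f (toℕ k)))
  (cong₂ _+_
    (sum-cong-≗ {n} (λ k → cong f (toℕ-inject₁ k)))
    (cong f (toℕ-fromℕ n)))

-- Truncated subtraction already contains the maximum with zero, so the induction can work in ℕ and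
-- the maximum appears only at the end.
0⊔[m⊖n]≡m∸n : ∀ m n → 0ℤ ⊔ (m ⊖ n) ≡ + (m ℕ.∸ n)
0⊔[m⊖n]≡m∸n m n with ℕ.≤-total n m
... | inj₁ n≤m rewrite ℤ.⊖-≥ n≤m = refl
... | inj₂ m≤n = begin
  0ℤ ⊔ (m ⊖ n)  ≡⟨ ℤ.i≥j⇒i⊔j≡i m⊖n≤0 ⟩
  0ℤ            ≡⟨ cong +_ (ℕ.m≤n⇒m∸n≡0 m≤n) ⟨
  + (m ℕ.∸ n)   ∎
  where
  open ≡-Reasoning
  m⊖n≤0 : m ⊖ n ≤ 0ℤ
  m⊖n≤0 = ℤ.≤-trans (ℤ.≤-reflexive (ℤ.⊖-≤ m≤n)) ℤ.neg-≤-pos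

-- As long as `x < m`, both sides vanish. From `m` up to `2m - 1` the quotient is exactly 1, which
-- is the growth of the difference.
1+x∸m≡[x∸m]+x/m : ∀ x m .{{_ : NonZero m}} → x ℕ.< m ℕ.+ m →
  suc x ℕ.∸ m ≡ (x ℕ.∸ m) ℕ.+ x ℕ./ m
1+x∸m≡[x∸m]+x/m x m x<m+m with ℕ.<-≤-connex x m
... | inj₁ x<m
  rewrite m<n⇒m/n≡0 x<m | ℕ.m≤n⇒m∸n≡0 (ℕ.<⇒≤ x<m) = ℕ.m≤n⇒m∸n≡0 x<m
... | inj₂ m≤x
  rewrite m/n≡1+[m∸n]/n m≤x
        | m<n⇒m/n≡0 (ℕ.m<n+o⇒m∸n<o x m x<m+m)
        | ℕ.+-∸-assoc 1 m≤x = ℕ.+-comm 1 (x ℕ.∸ m)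

-- Division with remainder writes `a` as `r + q * m`, and the multiple of `m` passes through the
-- floor.
[a+k]/m≡a/m+[a%m+k]/m : ∀ a k m .{{_ : NonZero m}} →
  (a ℕ.+ k) ℕ./ m ≡ a ℕ./ m ℕ.+ (a ℕ.% m ℕ.+ k) ℕ./ m
[a+k]/m≡a/m+[a%m+k]/m a k m = begin
  (a ℕ.+ k) ℕ./ m                      ≡⟨ /-congˡ {o = m} (cong (ℕ._+ k) (m≡m%n+[m/n]*n a m)) ⟩
  (r ℕ.+ q ℕ.* m ℕ.+ k) ℕ./ m          ≡⟨ /-congˡ {o = m} (rearrange r (q ℕ.* m)) ⟩
  (r ℕ.+ k ℕ.+ q ℕ.* m) ℕ./ m          ≡⟨ +-distrib-/-∣ʳ (r ℕ.+ k) (divides-refl q) ⟩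
  (r ℕ.+ k) ℕ./ m ℕ.+ q ℕ.* m ℕ./ m    ≡⟨ cong ((r ℕ.+ k) ℕ./ m ℕ.+_) (m*n/n≡m q m) ⟩
  (r ℕ.+ k) ℕ./ m ℕ.+ q                ≡⟨ ℕ.+-comm _ q ⟩
  q ℕ.+ (r ℕ.+ k) ℕ./ m                ∎
  where
  open ≡-Reasoning
  q = a ℕ./ m
  r = a ℕ.% m
  rearrange : ∀ x y → x ℕ.+ y ℕ.+ k ≡ x ℕ.+ k ℕ.+ y
  rearrange x y = ℕ-solve (x ∷ y ∷ k ∷ [])

-- Induction on the number `n` of terms. The bound `n ≤ m` includes equality because the largest
-- index is only `n - 1`.
∑-floor-differences : ∀ m .{{_ : NonZero m}} a n → n ℕ.≤ m →
  ∑[ k < n ] (+ ((a ℕ.+ toℕ k) ℕ./ m) - + (toℕ k ℕ./ m))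
    ≡ + (a ℕ./ m ℕ.* n ℕ.+ (a ℕ.% m ℕ.+ n ℕ.∸ m))
∑-floor-differences m a zero _
  rewrite ℕ.*-zeroʳ (a ℕ./ m) | ℕ.+-identityʳ (a ℕ.% m)
  = cong +_ (sym (ℕ.m≤n⇒m∸n≡0 (ℕ.<⇒≤ (m%n<n a m))))
∑-floor-differences m a (suc n) n<m = begin
  ∑[ k < suc n ] f (toℕ k)
    ≡⟨ ∑-toℕ-suc f n ⟩
  ∑[ k < n ] f (toℕ k) + f n
    ≡⟨ cong₂ _+_ (∑-floor-differences m a n (ℕ.<⇒≤ n<m)) f[n]≡ ⟩
  + (q ℕ.* n ℕ.+ (r ℕ.+ n ℕ.∸ m) ℕ.+ (q ℕ.+ (r ℕ.+ n) ℕ./ m))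
    ≡⟨ cong +_ (rearrange q (r ℕ.+ n ℕ.∸ m) ((r ℕ.+ n) ℕ./ m)) ⟩
  + (q ℕ.* suc n ℕ.+ ((r ℕ.+ n ℕ.∸ m) ℕ.+ (r ℕ.+ n) ℕ./ m))
    ≡⟨ cong (λ x → + (q ℕ.* suc n ℕ.+ x))
         (1+x∸m≡[x∸m]+x/m (r ℕ.+ n) m (ℕ.+-mono-< (m%n<n a m) n<m)) ⟨
  + (q ℕ.* suc n ℕ.+ (suc (r ℕ.+ n) ℕ.∸ m))
    ≡⟨ cong (λ x → + (q ℕ.* suc n ℕ.+ (x ℕ.∸ m))) (ℕ.+-suc r n) ⟨
  + (q ℕ.* suc n ℕ.+ (r ℕ.+ suc n ℕ.∸ m))
    ∎
  where
  open ≡-Reasoning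
  q = a ℕ./ m
  r = a ℕ.% m
  f : ℕ → ℤ
  f k = + ((a ℕ.+ k) ℕ./ m) - + (k ℕ./ m)
  f[n]≡ : f n ≡ + (q ℕ.+ (r ℕ.+ n) ℕ./ m)
  -- Since `n < m`, the subtracted floor is zero.
  f[n]≡ rewrite m<n⇒m/n≡0 n<m =
    trans (ℤ.+-identityʳ _) (cong +_ ([a+k]/m≡a/m+[a%m+k]/m a n m))
  rearrange : ∀ x y z →
    x ℕ.* n ℕ.+ y ℕ.+ (x ℕ.+ z) ≡ x ℕ.* suc n ℕ.+ (y ℕ.+ z)
  rearrange x y z = ℕ-solve (x ∷ y ∷ z ∷ n ∷ [])

proposition2 : (m : ℕ) .{{_ : NonZero m}} (K a₁ : ℕ) → + K ≤ + m - 1ℤ →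
    S m a₁ K ≡ + (a₁ ℕ./ m) * (+ K + 1ℤ) + (0ℤ ⊔ (+ (a₁ ℕ.% m) + + K - + m + 1ℤ))
proposition2 m K a₁ K≤m-1 = begin
  S m a₁ K
    -- The range `k ≤ K` has `suc K` terms.
    ≡⟨ ∑-floor-differences m a₁ (suc K) K<m ⟩
  + (q ℕ.* suc K) + + (r ℕ.+ suc K ℕ.∸ m)
    ≡⟨ cong₂ _+_ (ℤ.pos-* q (suc K)) (sym (0⊔[m⊖n]≡m∸n (r ℕ.+ suc K) m)) ⟩
  + q * + suc K + (0ℤ ⊔ (r ℕ.+ suc K ⊖ m))
    ≡⟨ cong₂ (λ x y → + q * x + (0ℤ ⊔ y)) (ℤ.+-comm 1ℤ (+ K)) r+1+K⊖m≡ ⟩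
  + q * (+ K + 1ℤ) + (0ℤ ⊔ (+ r + + K - + m + 1ℤ))
    ∎
  where
  open ≡-Reasoning
  q = a₁ ℕ./ m
  r = a₁ ℕ.% m
  K<m : K ℕ.< m
  -- The integer predecessor is `-1ℤ + j`, hence the swap of summands.
  K<m = ℤ.drop‿+<+ (ℤ.i≤pred[j]⇒i<j
    (ℤ.≤-trans K≤m-1 (ℤ.≤-reflexive (ℤ.+-comm (+ m) -1ℤ))))
  rearrange : ∀ x y z → x + (1ℤ + y) - z ≡ x + y - z + 1ℤ
  rearrange x y z = solve (x ∷ y ∷ z ∷ [])
  r+1+K⊖m≡ : r ℕ.+ suc K ⊖ m ≡ + r + + K - + m + 1ℤ
  -- The cast of `r + suc K` is by computation `+ r + (1ℤ + + K)`, the form that `rearrange`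
  -- expects.
  r+1+K⊖m≡ = trans (sym (ℤ.m-n≡m⊖n (r ℕ.+ suc K) m)) (rearrange (+ r) (+ K) (+ m))
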